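{- For an integer $n\ge 2$, let $c(n)$ denote the number of edge colorings $\phi\colon E(K_n)\to\{\text{red},\text{green},\text{blue}\}$ of the complete graph $K_n$ on $n$ labeled vertices that contain no rainbow triangle (a triangle whose three edges receive three distinct colors). Then for all $n\ge 2$, $$c(n)\le 7(n+1)\,2^{\binom{n}{2}}.$$
   Context: The vertices of $K_n$ are labeled, so distinct functions $\phi$ count as distinct colorings. Not all three colors need to be used. -}

module Defs where

open import Level using (0ℓ)
open import Data.Nat using (ℕ; _*_; _+_; _^_; _≤_)
open import Data.Nat.Combinatorics using (_C_)
open import Data.Fin using (Fin) renaming (_<_ to _<ᶠ_)
open import Data.Product using (Σ; _×_; _,_; proj₁)
open import Data.Empty using (⊥)
open import Relation.Nullary using (¬_)
open import Relation.Binary.PropositionalEquality using (_≡_; refl; sym; trans) renaming (setoid to ≡-setoid)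
open import Relation.Binary.Bundles using (Setoid)
open import Function.Bundles using (Bijection)

data Color : Set where
  red green blue : Color

-- An edge of K_n on vertex set Fin n: an unordered pair {i , j}, i ≠ j,
-- represented canonically as an ordered pair with i < j.
Edge : ℕ → Set
Edge n = Σ (Fin n) λ i → Σ (Fin n) λ j → i <ᶠ j

Coloring : ℕ → Set
Coloring n = Edge n → Color

AllDistinct : Color → Color → Color → Set
AllDistinct a b c = ¬ (a ≡ b) × ¬ (b ≡ c) × ¬ (a ≡ c)

HasRainbowTriangle : ∀ {n} → Coloring n → Set
HasRainbowTriangle {n} φ =
  Σ (Fin n) λ i → Σ (Fin n) λ j → Σ (Fin n) λ k →
  Σ (i <ᶠ j) λ ij → Σ (j <ᶠ k) λ jk → Σ (i <ᶠ k) λ ik →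
    AllDistinct (φ (i , j , ij)) (φ (j , k , jk)) (φ (i , k , ik))

RainbowFree : ℕ → Set
RainbowFree n = Σ (Coloring n) λ φ → ¬ HasRainbowTriangle φ

RainbowFreeSetoid : ℕ → Setoid 0ℓ 0ℓ
RainbowFreeSetoid n = record
  { Carrier = RainbowFree n
  ; _≈_ = λ φ ψ → (e : Edge n) → proj₁ φ e ≡ proj₁ ψ e
  ; isEquivalence = record
    { refl = λ e → refl
    ; sym = λ p e → sym (p e)
    ; trans = λ p q e → trans (p e) (q e)
    }
  }

-- "The number of rainbow-free colourings of K_n is k":
-- a bijection between them (up to equality of colourings) and Fin k.
HasCount : ℕ → ℕ → Set
HasCount n k = Bijection (RainbowFreeSetoid n) (≡-setoid (Fin k))

{-# OPTIONS --safe #-}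

-- By Gallai's theorem some colour class x of a rainbow-free colouring is disconnected
-- (induction on the vertices), and every vertex outside an x-component sees that
-- component in a single colour. Hence a colouring using all three colours has a module of
-- size 2 ≤ m < n, and is determined by the module, its colouring and the colouring of the
-- quotient, so that
--   c(n) ≤ 3·2^C(n,2) + Σ_{2 ≤ m < n} C(n,m) c(m) c(n−m+1).
-- The summands are about 2^(−(m−1)(n−m))·2^C(n,2), whence c(n) ≤ 48·2^C(n,2) for n ≥ 8 by
-- induction. The recurrence is too weak for small n; there one inserts vertices one at a
-- time: two distinct rows extending a colouring leave at most two colours for the edge
-- between the new vertices, so a colouring of K_n has at most 2^(n+1) − 1 extensions.
module Submission where

open import Defs
open import Data.Nat using (ℕ; _*_; _+_; _^_; _≤_)
open import Data.Nat.Combinatorics using (_C_)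
open import Data.Bool using (Bool; true; false; if_then_else_)
open import Data.Empty using (⊥; ⊥-elim)
open import Data.Fin using (Fin; zero; suc; combine; join; splitAt; inject≤; _≟_) renaming (_<_ to _<ᶠ_)
open import Data.Fin.Properties using (any?; combine-injective; splitAt-join; inject≤-injective; suc-injective; <-cmp; <-irrelevant; injective⇒≤; 0≢1+n; ¬Fin0)
open import Data.Maybe using (Maybe; just; nothing)
open import Data.Nat using (zero; suc; _<_; z≤n; s≤s; _<ᵇ_; NonZero)
open import Data.Nat.Combinatorics using (nCk+nC[k+1]≡[n+1]C[k+1]; nC1≡n)
open import Data.Nat.Induction using (<-rec)
open import Data.Nat.Properties hiding (_≟_; <-cmp; <-irrelevant; 0≢1+n) renaming (suc-injective to ℕ-suc-injective)
open import Data.Nat.Tactic.RingSolver using (solve-∀)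
open import Data.Product using (Σ; Σ-syntax; ∃; _×_; _,_; proj₁; proj₂)
open import Data.Sum using (_⊎_; inj₁; inj₂)
open import Data.Sum.Properties using (inj₁-injective; inj₂-injective)
open import Data.Unit using (⊤; tt)
open import Data.Vec using (Vec; []; _∷_; lookup; tabulate)
open import Data.Vec.Properties using (lookup∘tabulate; tabulate-cong)
open import Function using (_∘_)
open import Function.Bundles using (Bijection)
open import Relation.Binary.Definitions using (DecidableEquality; Tri; tri<; tri≈; tri>)
open import Relation.Binary.PropositionalEquality using (_≡_; _≢_; refl; sym; trans; cong; cong₂; subst; ≢-sym)
open import Relation.Nullary using (¬_; Dec; yes; no; does; contradiction)
open import Relation.Nullary.Decidable using (_×-dec_; ¬?; dec-true; dec-false)

-- Colours, colour matrices and codes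

_≟ᶜ_ : DecidableEquality Color
red   ≟ᶜ red   = yes refl
red   ≟ᶜ green = no λ ()
red   ≟ᶜ blue  = no λ ()
green ≟ᶜ red   = no λ ()
green ≟ᶜ green = yes refl
green ≟ᶜ blue  = no λ ()
blue  ≟ᶜ red   = no λ ()
blue  ≟ᶜ green = no λ ()
blue  ≟ᶜ blue  = yes refl

allDistinct-swap : ∀ {a b c} → AllDistinct a b c → AllDistinct b a c
allDistinct-swap (p , q , r) = ≢-sym p , r , q

allDistinct-rotate : ∀ {a b c} → AllDistinct a b c → AllDistinct b c a
allDistinct-rotate (p , q , r) = q , ≢-sym r , ≢-sym p

¬distinct⇒≡ : ∀ {a b c} → ¬ AllDistinct a b c → b ≢ c → a ≢ c → a ≡ b
¬distinct⇒≡ {a} {b} nd b≢c a≢c with a ≟ᶜ b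
... | yes eq = eq
... | no neq = contradiction (neq , b≢c , a≢c) nd

Matrix : ℕ → Set
Matrix n = Fin n → Fin n → Color

pullback : ∀ {m n} → (Fin m → Fin n) → Matrix n → Matrix m
pullback ι c i j = c (ι i) (ι j)

-- A constant diagonal makes degenerate triangles harmless, so that `Gallai` is
-- stable under pullback along arbitrary maps.
record Gallai {n : ℕ} (c : Matrix n) : Set where
  field
    diagonal  : ∀ i → c i i ≡ red
    symmetric : ∀ i j → c i j ≡ c j i
    rainbow-free : ∀ i j k → ¬ AllDistinct (c i j) (c j k) (c i k)

open Gallai

gallai-pullback : ∀ {m n} (ι : Fin m → Fin n) {c : Matrix n} → Gallai c → Gallai (pullback ι c)
gallai-pullback ι g = record
  { diagonal = λ i → diagonal g (ι i)
  ; symmetric = λ i j → symmetric g (ι i) (ι j)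
  ; rainbow-free = λ i j k → rainbow-free g (ι i) (ι j) (ι k)
  }

infix 4 _≗₂_
_≗₂_ : ∀ {n} → Matrix n → Matrix n → Set
c ≗₂ d = ∀ i j → c i j ≡ d i j

≗₂-from-row-and-tail : ∀ {n} {c d : Matrix (suc n)} → Gallai c → Gallai d →
  (∀ j → c zero (suc j) ≡ d zero (suc j)) → pullback suc c ≗₂ pullback suc d → c ≗₂ d
≗₂-from-row-and-tail gc gd row rest zero zero = trans (diagonal gc zero) (sym (diagonal gd zero))
≗₂-from-row-and-tail gc gd row rest zero (suc j) = row j
≗₂-from-row-and-tail gc gd row rest (suc i) zero =
  trans (symmetric gc (suc i) zero) (trans (row i) (symmetric gd zero (suc i)))
≗₂-from-row-and-tail gc gd row rest (suc i) (suc j) = rest i j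

-- An upper bound `k` on the number of Gallai colourings, given as an injection. The code may depend
-- on the proof of `Gallai`, so injectivity quantifies over both proofs.
record Code (n k : ℕ) : Set where
  field
    encode    : (c : Matrix n) → Gallai c → Fin k
    injective : ∀ {c d} (gc : Gallai c) (gd : Gallai d) → encode c gc ≡ encode d gd → c ≗₂ d

code-mono : ∀ {n k l} → k ≤ l → Code n k → Code n l
code-mono k≤l 𝒞 = record
  { encode = λ c g → inject≤ (encode c g) k≤l
  ; injective = λ gc gd eq → injective gc gd (inject≤-injective k≤l k≤l _ _ eq)
  } where open Code 𝒞

-- Vertex insertion

-- The entries above the diagonal as plain data: by `triangle-cong`, pointwise equal matrices have
-- identical triangles, so a code may safely depend on one.
Triangle : ℕ → Set
Triangle zero    = ⊤
Triangle (suc n) = Vec Color n × Triangle n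

triangle : ∀ {n} → Matrix n → Triangle n
triangle {zero}  c = tt
triangle {suc n} c = tabulate (c zero ∘ suc) , triangle (pullback suc c)

triangle-cong : ∀ {n} {c d : Matrix n} → c ≗₂ d → triangle c ≡ triangle d
triangle-cong {zero}  eq = refl
triangle-cong {suc n} eq =
  cong₂ _,_ (tabulate-cong (λ j → eq zero (suc j))) (triangle-cong (λ i j → eq (suc i) (suc j)))

-- The vector is the row of a new vertex; each step handles the triangles through that vertex and
-- the first vertex of the remaining triangle.
Extends : ∀ {n} → Triangle n → Vec Color n → Set
Extends t [] = ⊤
Extends (y , t) (z ∷ x) = (∀ u → ¬ AllDistinct z (lookup y u) (lookup x u)) × Extends t x

extends : ∀ {n} (c : Matrix n) (x : Fin n → Color) →
  (∀ i j → ¬ AllDistinct (x i) (c i j) (x j)) → Extends (triangle c) (tabulate x)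
extends {zero}  c x nd = tt
extends {suc n} c x nd = first , extends (pullback suc c) (x ∘ suc) (λ i j → nd (suc i) (suc j))
  where
  first : ∀ u → ¬ AllDistinct (x zero) (lookup (tabulate (c zero ∘ suc)) u) (lookup (tabulate (x ∘ suc)) u)
  first u rewrite lookup∘tabulate (c zero ∘ suc) u | lookup∘tabulate (x ∘ suc) u = nd zero (suc u)

firstDifference : ∀ {n} → Vec Color n → Vec Color n → Maybe (Color × Color)
firstDifference [] [] = nothing
firstDifference (a ∷ x) (b ∷ y) with a ≟ᶜ b
... | yes _ = firstDifference x y
... | no  _ = just (a , b)

firstDifference-nothing : ∀ {n} (x y : Vec Color n) → firstDifference x y ≡ nothing → x ≡ y
firstDifference-nothing [] [] eq = refl
firstDifference-nothing (a ∷ x) (b ∷ y) eq with a ≟ᶜ b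
... | yes refl = cong (a ∷_) (firstDifference-nothing x y eq)

firstDifference-just : ∀ {n p q} (x y : Vec Color n) → firstDifference x y ≡ just (p , q) →
  p ≢ q × ∃ λ u → lookup x u ≡ p × lookup y u ≡ q
firstDifference-just [] [] ()
firstDifference-just (a ∷ x) (b ∷ y) eq with a ≟ᶜ b
firstDifference-just (a ∷ x) (b ∷ y) refl | no a≢b = a≢b , zero , refl , refl
... | yes _ with p≢q , u , eqs ← firstDifference-just x y eq = p≢q , suc u , eqs

-- The colour z of the edge joining two new vertices with rows x and y: if x and y
-- differ somewhere, z is one of the two colours there, so one bit suffices; only
-- x = y leaves a third possibility, reported as `nothing`.
choice : Maybe (Color × Color) → Color → Maybe (Fin 2)
choice nothing        red   = just zero
choice nothing        green = just (suc zero)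
choice nothing        blue  = nothing
choice (just (p , q)) z     = just (if does (z ≟ᶜ p) then zero else suc zero)

choice-nothing : ∀ d z → choice d z ≡ nothing → d ≡ nothing × z ≡ blue
choice-nothing nothing blue eq = refl , refl

choice-injective : ∀ d {z w} → (∀ {p q} → d ≡ just (p , q) → p ≢ q × ¬ AllDistinct z p q × ¬ AllDistinct w p q) →
  choice d z ≡ choice d w → z ≡ w
choice-injective nothing {red}   {red}   _ eq = refl
choice-injective nothing {green} {green} _ eq = refl
choice-injective nothing {blue}  {blue}  _ eq = refl
choice-injective (just (p , q)) {z} {w} h eq with z ≟ᶜ p | w ≟ᶜ p | h refl
... | yes refl | yes refl | _ = refl
... | no z≢p | no w≢p | p≢q , nz , nw = trans (forced z≢p nz) (sym (forced w≢p nw))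
  where
  forced : ∀ {z} → z ≢ p → ¬ AllDistinct z p q → z ≡ q
  forced z≢p nd = ¬distinct⇒≡ (nd ∘ allDistinct-swap ∘ allDistinct-rotate ∘ allDistinct-rotate) (≢-sym p≢q) z≢p

-- extensionBound n = 2 ^ (n + 1) − 1
extensionBound : ℕ → ℕ
extensionBound zero    = 1
extensionBound (suc n) = suc (extensionBound n * 2)

-- The index is dropped in the case `nothing`: the rest of the row then equals a row that is already
-- known, so one extra value suffices.
packChoice : ∀ {k} → Fin k → Maybe (Fin 2) → Fin (suc (k * 2))
packChoice i nothing  = zero
packChoice i (just b) = suc (combine i b)

packChoice-injective : ∀ {k} (i j : Fin k) (a b : Maybe (Fin 2)) → packChoice i a ≡ packChoice j b →
  a ≡ b × (i ≡ j ⊎ a ≡ nothing)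
packChoice-injective i j nothing nothing eq = refl , inj₂ refl
packChoice-injective i j (just a) (just b) eq with combine-injective i a j b (suc-injective eq)
... | refl , refl = refl , inj₁ refl

encodeRow : ∀ {n} → Triangle n → Vec Color n → Fin (extensionBound n)
encodeRow t [] = zero
encodeRow (y , t) (z ∷ x) = packChoice (encodeRow t x) (choice (firstDifference y x) z)

encodeRow-injective : ∀ {n} (t : Triangle n) (x y : Vec Color n) → Extends t x → Extends t y →
  encodeRow t x ≡ encodeRow t y → x ≡ y
encodeRow-injective t [] [] _ _ eq = refl
encodeRow-injective (r , t) (z ∷ x) (w ∷ y) (zx , ex) (wy , ey) eq
  with packChoice-injective (encodeRow t x) (encodeRow t y) _ _ eq
... | same , inj₁ rows with refl ← encodeRow-injective t x y ex ey rows =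
  cong (_∷ x) (choice-injective (firstDifference r x) witness same)
  where
  witness : ∀ {p q} → firstDifference r x ≡ just (p , q) → p ≢ q × ¬ AllDistinct z p q × ¬ AllDistinct w p q
  witness d with p≢q , u , refl , refl ← firstDifference-just r x d = p≢q , zx u , wy u
-- Both rows coincide with `r` here, so their dropped codes are not missed.
... | same , inj₂ none
  with dx , refl ← choice-nothing _ z none | dy , refl ← choice-nothing _ w (trans (sym same) none) =
  cong (blue ∷_) (trans (sym (firstDifference-nothing r x dx)) (firstDifference-nothing r y dy))

code-insert : ∀ {n k} → Code n k → Code (suc n) (extensionBound n * k)
code-insert {n} {k} 𝒞 = record { encode = enc ; injective = inj }
  where
  open Code 𝒞
  tailOf : ∀ {c : Matrix (suc n)} → Gallai c → Gallai (pullback suc c)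
  tailOf = gallai-pullback suc
  row : Matrix (suc n) → Vec Color n
  row c = tabulate (c zero ∘ suc)
  enc : (c : Matrix (suc n)) → Gallai c → Fin (extensionBound n * k)
  enc c g = combine (encodeRow (triangle (pullback suc c)) (row c)) (encode (pullback suc c) (tailOf g))
  row-extends : ∀ {c} → Gallai c → Extends (triangle (pullback suc c)) (row c)
  row-extends {c} g = extends (pullback suc c) (c zero ∘ suc)
    λ i j nd → rainbow-free g zero (suc i) (suc j) nd
  inj : ∀ {c d} (gc : Gallai c) (gd : Gallai d) → enc c gc ≡ enc d gd → c ≗₂ d
  inj {c} {d} gc gd eq with combine-injective _ _ _ _ eq
  ... | rows , tails = ≗₂-from-row-and-tail gc gd row≗ rest
    where
    rest : pullback suc c ≗₂ pullback suc d
    rest = injective (tailOf gc) (tailOf gd) tails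
    -- The row codes are relative to the triangles of the two tails, so the tails have to be decoded
    -- first.
    row≡ : row c ≡ row d
    row≡ = encodeRow-injective (triangle (pullback suc c)) (row c) (row d) (row-extends gc)
      (subst (λ t → Extends t (row d)) (sym (triangle-cong rest)) (row-extends gd))
      (trans rows (cong (λ t → encodeRow t (row d)) (sym (triangle-cong rest))))
    row≗ : ∀ j → c zero (suc j) ≡ d zero (suc j)
    row≗ j = trans (sym (lookup∘tabulate (c zero ∘ suc) j))
      (trans (cong (λ v → lookup v j) row≡) (lookup∘tabulate (d zero ∘ suc) j))

insertionBound : ℕ → ℕ
insertionBound zero    = 1
insertionBound (suc n) = extensionBound n * insertionBound n

code-insertion : ∀ n → Code n (insertionBound n)
code-insertion zero    = record { encode = λ _ _ → zero ; injective = λ _ _ _ () }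
code-insertion (suc n) = code-insert (code-insertion n)

-- Colourings missing a colour

-- This is 2 ^ (n choose 2), by `pairPower≡`, grown one row at a time to match `encodeMissing`.
pairPower : ℕ → ℕ
pairPower zero    = 1
pairPower (suc n) = 2 ^ n * pairPower n

-- Tells apart the two colours other than the first argument; the bit of that colour itself is
-- arbitrary.
bit : Color → Color → Fin 2
bit red   green = zero
bit red   _     = suc zero
bit green blue  = zero
bit green _     = suc zero
bit blue  red   = zero
bit blue  _     = suc zero

bit-injective : ∀ x {a b} → a ≢ x → b ≢ x → bit x a ≡ bit x b → a ≡ b
bit-injective red   {red}   a≢ b≢ eq = contradiction refl a≢
bit-injective red   {_} {red} a≢ b≢ eq = contradiction refl b≢
bit-injective red   {green} {green} a≢ b≢ eq = refl
bit-injective red   {blue}  {blue}  a≢ b≢ eq = refl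
bit-injective green {green} a≢ b≢ eq = contradiction refl a≢
bit-injective green {_} {green} a≢ b≢ eq = contradiction refl b≢
bit-injective green {red}   {red}   a≢ b≢ eq = refl
bit-injective green {blue}  {blue}  a≢ b≢ eq = refl
bit-injective blue  {blue}  a≢ b≢ eq = contradiction refl a≢
bit-injective blue  {_} {blue} a≢ b≢ eq = contradiction refl b≢
bit-injective blue  {red}   {red}   a≢ b≢ eq = refl
bit-injective blue  {green} {green} a≢ b≢ eq = refl

bits : ∀ {n} → Color → (Fin n → Color) → Fin (2 ^ n)
bits {zero}  x r = zero
bits {suc n} x r = combine (bit x (r zero)) (bits x (r ∘ suc))

bits-injective : ∀ {n} x {r s : Fin n → Color} → (∀ i → r i ≢ x) → (∀ i → s i ≢ x) →
  bits x r ≡ bits x s → ∀ i → r i ≡ s i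
bits-injective {suc n} x {r} {s} r≢ s≢ eq i
  with i | combine-injective {2} {2 ^ n} (bit x (r zero)) (bits x (r ∘ suc)) (bit x (s zero)) (bits x (s ∘ suc)) eq
... | zero  | head , _ = bit-injective x (r≢ zero) (s≢ zero) head
... | suc i | _ , rest = bits-injective x (r≢ ∘ suc) (s≢ ∘ suc) rest i

Misses : ∀ {n} → Color → Matrix n → Set
Misses x c = ∀ i j → i ≢ j → c i j ≢ x

encodeMissing : ∀ {n} → Color → Matrix n → Fin (pairPower n)
encodeMissing {zero}  x c = zero
encodeMissing {suc n} x c = combine (bits x (c zero ∘ suc)) (encodeMissing x (pullback suc c))

encodeMissing-injective : ∀ {n} x {c d : Matrix n} → Gallai c → Gallai d → Misses x c → Misses x d →
  encodeMissing x c ≡ encodeMissing x d → c ≗₂ d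
encodeMissing-injective {zero} x gc gd mc md eq ()
encodeMissing-injective {suc n} x gc gd mc md eq with combine-injective {2 ^ n} {pairPower n} _ _ _ _ eq
... | rows , rest = ≗₂-from-row-and-tail gc gd
  (bits-injective x (λ j → mc zero (suc j) 0≢1+n) (λ j → md zero (suc j) 0≢1+n) rows)
  (encodeMissing-injective x (gallai-pullback suc gc) (gallai-pullback suc gd)
    (λ i j i≢j → mc (suc i) (suc j) (i≢j ∘ suc-injective))
    (λ i j i≢j → md (suc i) (suc j) (i≢j ∘ suc-injective)) rest)

colorIndex : Color → Fin 3
colorIndex red   = zero
colorIndex green = suc zero
colorIndex blue  = suc (suc zero)

colorIndex-injective : ∀ {a b} → colorIndex a ≡ colorIndex b → a ≡ b
colorIndex-injective {red}   {red}   eq = refl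
colorIndex-injective {green} {green} eq = refl
colorIndex-injective {blue}  {blue}  eq = refl

Uses : ∀ {n} → Color → Matrix n → Set
Uses {n} x c = Σ[ i ∈ Fin n ] Σ[ j ∈ Fin n ] (i ≢ j × c i j ≡ x)

uses? : ∀ {n} x (c : Matrix n) → Dec (Uses x c)
uses? x c = any? λ i → any? λ j → ¬? (i ≟ j) ×-dec (c i j ≟ᶜ x)

misses-or-uses-all : ∀ {n} (c : Matrix n) → (∃ λ x → Misses x c) ⊎ (∀ x → Uses x c)
misses-or-uses-all c with uses? red c | uses? green c | uses? blue c
... | no ¬u | _ | _ = inj₁ (red , λ i j i≢j eq → ¬u (i , j , i≢j , eq))
... | yes _ | no ¬u | _ = inj₁ (green , λ i j i≢j eq → ¬u (i , j , i≢j , eq))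
... | yes _ | yes _ | no ¬u = inj₁ (blue , λ i j i≢j eq → ¬u (i , j , i≢j , eq))
... | yes r | yes g | yes b = inj₂ λ { red → r ; green → g ; blue → b }

-- Components of a colour class

Respects : ∀ {n} {B : Set} → Matrix n → Color → (Fin n → B) → Set
Respects c x y = ∀ i j → c i j ≡ x → y i ≡ y j

-- Connectedness of the classes is expressed without paths: the labelling is the
-- finest one that is constant along edges of colour x.
record Components {n : ℕ} (c : Matrix n) (x : Color) : Set₁ where
  field
    label    : Fin n → Fin n
    respects : Respects c x label
    finest   : ∀ {B : Set} (y : Fin n → B) → Respects c x y → ∀ i j → label i ≡ label j → y i ≡ y j

-- Induction on the vertices: vertex zero fuses all components that it meets in an x-edge into one
-- class labelled `zero`, and the other labels are shifted.
components : ∀ {n} {c : Matrix n} → Gallai c → ∀ x → Components c x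
components {zero} g x = record { label = λ () ; respects = λ () ; finest = λ _ _ () }
components {suc n} {c} g x = record { label = label′ ; respects = respects′ ; finest = finest′ }
  where
  open Components (components (gallai-pullback suc g) x)
  Touches : Fin n → Set
  Touches l = ∃ λ j → label j ≡ l × c zero (suc j) ≡ x
  touches? : ∀ l → Dec (Touches l)
  touches? l = any? λ j → (label j ≟ l) ×-dec (c zero (suc j) ≟ᶜ x)
  merge : Fin n → Fin (suc n)
  merge l = if does (touches? l) then zero else suc l
  label′ : Fin (suc n) → Fin (suc n)
  label′ zero    = zero
  label′ (suc i) = merge (label i)
  merge-touched : ∀ {j} → c zero (suc j) ≡ x → zero ≡ merge (label j)
  merge-touched {j} e with touches? (label j)
  ... | yes _ = refl
  ... | no ¬t = contradiction (j , refl , e) ¬t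
  respects′ : Respects c x label′
  respects′ zero zero e = refl
  respects′ zero (suc j) e = merge-touched e
  respects′ (suc i) zero e = sym (merge-touched (trans (symmetric g zero (suc i)) e))
  respects′ (suc i) (suc j) e = cong merge (respects i j e)
  module _ {B : Set} (y : Fin (suc n) → B) (ry : Respects c x y) where
    finest-suc : ∀ i j → label i ≡ label j → y (suc i) ≡ y (suc j)
    finest-suc = finest (y ∘ suc) (λ i j → ry (suc i) (suc j))
    finest-zero : ∀ j → Touches (label j) → y zero ≡ y (suc j)
    finest-zero j (k , lk≡lj , e) = trans (ry zero (suc k) e) (finest-suc k j lk≡lj)
    finest′ : ∀ i j → label′ i ≡ label′ j → y i ≡ y j
    finest′ zero zero eq = refl
    finest′ zero (suc j) eq with touches? (label j)
    ... | yes t = finest-zero j t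
    finest′ (suc i) zero eq with touches? (label i)
    ... | yes t = sym (finest-zero i t)
    finest′ (suc i) (suc j) eq with touches? (label i) | touches? (label j)
    ... | yes s | yes t = trans (sym (finest-zero i s)) (finest-zero j t)
    ... | no _ | no _ = finest-suc i j (suc-injective eq)

module _ {n} {c : Matrix n} (g : Gallai c) {x : Color} (𝒞 : Components c x) where
  open Components 𝒞

  separated : ∀ {i j} → label i ≢ label j → c i j ≢ x
  separated li≢lj e = li≢lj (respects _ _ e)

  -- Across an x-edge st inside the component, sw and tw are not x, so they agree, as the triangle
  -- is not rainbow. The colour seen from `w` is thus constant along x-edges, and `finest` spreads
  -- this to the component.
  component-uniform : ∀ i j w → label i ≡ label j → label w ≢ label i → c i w ≡ c j w
  component-uniform i j w li≡lj lw≢li = trans (sym (seen refl)) (trans (finest view view-respects i j li≡lj) (seen (sym li≡lj)))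
    where
    view : Fin n → Color
    -- Outside the component any constant will do: no x-edge crosses its boundary.
    view t = if does (label t ≟ label i) then c t w else red
    seen : ∀ {t} → label t ≡ label i → view t ≡ c t w
    seen {t} eq rewrite dec-true (label t ≟ label i) eq = refl
    view-respects : Respects c x view
    view-respects s t e with label s ≟ label i | label t ≟ label i
    ... | yes p | yes q = sym (¬distinct⇒≡
      (λ nd → rainbow-free g s t w (allDistinct-rotate (allDistinct-rotate nd)))
      (λ e′ → lw≢li (trans (sym (respects s w (trans e′ e))) p))
      (λ e′ → lw≢li (trans (sym (respects t w (trans e′ e))) q)))
    ... | yes p | no ¬q = contradiction (trans (sym (respects s t e)) p) ¬q
    ... | no ¬p | yes q = contradiction (trans (respects s t e) q) ¬p
    ... | no _ | no _ = refl

-- Gallai's theorem: some colour class is disconnected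

Cut : ∀ {n} → Matrix n → Color → Set
Cut {n} c x = Σ[ y ∈ (Fin n → Bool) ] (Respects c x y × ∃ λ i → ∃ λ j → y i ≢ y j)

-- By `finest`, the two vertices separated by the cut have different labels, so one of them differs
-- from that of `a`.
cut⇒label-elsewhere : ∀ {n} {c : Matrix n} {x} (𝒞 : Components c x) → Cut c x →
  ∀ a → ∃ λ w → Components.label 𝒞 w ≢ Components.label 𝒞 a
cut⇒label-elsewhere 𝒞 (y , ry , i , j , yi≢yj) a with Components.label 𝒞 i ≟ Components.label 𝒞 a
... | yes eq = j , λ eq′ → yi≢yj (Components.finest 𝒞 y ry i j (trans eq (sym eq′)))
... | no neq = i , neq

isolated : ∀ {n} {c : Matrix (suc (suc n))} → Gallai c → ∀ {x} → (∀ j → c zero (suc j) ≢ x) → Cut c x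
isolated {n} {c} g {x} none = isZero , respectsZero , zero , suc zero , λ ()
  where
  isZero : Fin (suc (suc n)) → Bool
  isZero zero    = true
  isZero (suc _) = false
  respectsZero : Respects c x isZero
  respectsZero zero zero e = refl
  respectsZero zero (suc j) e = contradiction e (none j)
  respectsZero (suc i) zero e = contradiction (trans (symmetric g zero (suc i)) e) (none i)
  respectsZero (suc i) (suc j) e = refl

next : Color → Color
next red   = green
next green = blue
next blue  = red

next≢ : ∀ x → next x ≢ x
next≢ red   ()
next≢ green ()
next≢ blue  ()

next²≢ : ∀ x → next (next x) ≢ x
next²≢ red   ()
next²≢ green ()
next²≢ blue  ()

-- Let x be disconnected once vertex zero is removed. If zero has an x-edge to every
-- x-component, then an edge of another colour z from zero to a forces all edges from a
-- to other components to be z; this cannot happen for both other colours.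
exists-cut : ∀ {n} {c : Matrix (suc (suc n))} → Gallai c → ∃ (Cut c)
exists-cut {zero} {c} g = next (c zero (suc zero)) , isolated g λ { zero e → next≢ _ (sym e) }
exists-cut {suc n} {c} g with exists-cut (gallai-pullback suc g)
... | x , cut′ with components (gallai-pullback suc g) x
... | 𝒞 with any? (λ i → ¬? (any? λ j → (Components.label 𝒞 j ≟ Components.label 𝒞 i) ×-dec (c zero (suc j) ≟ᶜ x)))
-- No x-edge joins zero to the component of `i`, so that component is still one side of a cut, with
-- zero on the other.
... | yes (i , untouched) = x , inComponent , respectsComponent , zero , suc i , differ
  where
  open Components 𝒞
  inComponent : Fin (3 + n) → Bool
  inComponent zero    = false
  inComponent (suc j) = does (label j ≟ label i)
  outside : ∀ {j} → c zero (suc j) ≡ x → false ≡ inComponent (suc j)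
  outside {j} e = sym (dec-false (label j ≟ label i) λ eq → untouched (j , eq , e))
  respectsComponent : Respects c x inComponent
  respectsComponent zero zero e = refl
  respectsComponent zero (suc j) e = outside e
  respectsComponent (suc j) zero e = sym (outside (trans (symmetric g zero (suc j)) e))
  respectsComponent (suc j) (suc k) e = cong (λ l → does (l ≟ label i)) (respects j k e)
  differ : inComponent zero ≢ inComponent (suc i)
  differ rewrite dec-true (label i ≟ label i) refl = λ ()
... | no allTouched with any? (λ j → c zero (suc j) ≟ᶜ next x) | any? (λ j → c zero (suc j) ≟ᶜ next (next x))
... | no none | _ = next x , isolated g λ j e → none (j , e)
... | yes _ | no none = next (next x) , isolated g λ j e → none (j , e)
... | yes (a , ea) | yes (b , eb) = ⊥-elim absurd
  where
  open Components 𝒞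
  g′ : Gallai (pullback suc c)
  g′ = gallai-pullback suc g
  touched : ∀ i → ∃ λ j → label j ≡ label i × c zero (suc j) ≡ x
  touched i with any? (λ j → (label j ≟ label i) ×-dec (c zero (suc j) ≟ᶜ x))
  ... | yes t = t
  ... | no ¬t = contradiction (i , ¬t) allTouched
  forced : ∀ {z} i w → z ≢ x → c zero (suc i) ≡ z → label w ≢ label i → c (suc i) (suc w) ≡ z
  forced i w z≢x ez lw≢li with touched w
  -- In the triangle on zero, `i` and `v` only the edge from zero to `v` is x, so the other two
  -- edges agree; uniformity carries this from `v` to `w`.
  ... | v , lv≡lw , ex = trans
      (trans (symmetric g′ i w)
        (trans (component-uniform g′ 𝒞 w v i (sym lv≡lw) (≢-sym lw≢li)) (symmetric g′ v i)))
      (trans (sym (¬distinct⇒≡ (rainbow-free g zero (suc i) (suc v))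
        (λ e → separated g′ 𝒞 lv≢li (trans (symmetric g′ v i) (trans e ex)))
        (λ e → z≢x (trans (sym ez) (trans e ex))))) ez)
    where
    lv≢li : label v ≢ label i
    lv≢li eq = lw≢li (trans (sym lv≡lw) eq)
  absurd : ⊥
  -- If `a` and `b` lie in different components, their edge is forced to have both other colours.
  -- Otherwise they see a common `w` elsewhere in one colour, which is again forced to be both.
  absurd with label b ≟ label a
  ... | no lb≢la = next≢ (next x) (trans
      (sym (forced b a (next²≢ x) eb (≢-sym lb≢la)))
      (trans (symmetric g′ b a) (forced a b (next≢ x) ea lb≢la)))
  ... | yes lb≡la with cut⇒label-elsewhere 𝒞 cut′ a
  ...   | w , lw≢la = next≢ (next x) (trans
      (sym (forced b w (next²≢ x) eb λ eq → lw≢la (trans eq lb≡la)))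
      (trans (component-uniform g′ 𝒞 b a w lb≡la λ eq → lw≢la (trans eq lb≡la)) (forced a w (next≢ x) ea lw≢la)))

-- Modules

-- Two vertices inside and one outside make both the module and the quotient smaller than the whole.
record Module {n : ℕ} (c : Matrix n) (A : Vec Bool n) : Set where
  field
    {inside₁ inside₂ outside} : Fin n
    distinct  : inside₁ ≢ inside₂
    inside₁∈ : lookup A inside₁ ≡ true
    inside₂∈ : lookup A inside₂ ≡ true
    outside∉ : lookup A outside ≡ false
    uniform : ∀ i j w → lookup A i ≡ true → lookup A j ≡ true → lookup A w ≡ false → c i w ≡ c j w

-- Take a disconnected colour x and the x-component of an end of some x-edge: it contains both ends,
-- is not everything, and is uniform from outside.
exists-module : ∀ {n} {c : Matrix n} → 2 ≤ n → Gallai c → (∀ x → Uses x c) → ∃ (Module c)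
exists-module {suc (suc n)} {c} (s≤s (s≤s _)) g uses with exists-cut g
... | x , cut with components g x | uses x
... | 𝒞 | i , j , i≢j , e with cut⇒label-elsewhere 𝒞 cut i
... | w , lw≢li = A , record
  { outside  = w
  ; distinct = i≢j
  ; inside₁∈ = member refl
  ; inside₂∈ = member (sym (respects i j e))
  ; outside∉ = trans (lookup-A w) (dec-false (label w ≟ label i) lw≢li)
  ; uniform  = λ s t v s∈ t∈ v∉ → component-uniform g 𝒞 s t v
      (trans (member⁻¹ s∈) (sym (member⁻¹ t∈)))
      λ eq → contradiction (trans (sym (member (trans eq (member⁻¹ s∈)))) v∉) λ ()
  }
  where
  open Components 𝒞
  A : Vec Bool (suc (suc n))
  A = tabulate λ t → does (label t ≟ label i)
  lookup-A : ∀ t → lookup A t ≡ does (label t ≟ label i)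
  lookup-A = lookup∘tabulate _
  member : ∀ {t} → label t ≡ label i → lookup A t ≡ true
  member {t} eq = trans (lookup-A t) (dec-true (label t ≟ label i) eq)
  member⁻¹ : ∀ {t} → lookup A t ≡ true → label t ≡ label i
  member⁻¹ {t} t∈ with label t ≟ label i | lookup-A t
  ... | yes eq | _ = eq
  ... | no _ | eq = contradiction (trans (sym t∈) eq) λ ()

-- Encoding a subset together with data whose type depends on its size

size cosize : ∀ {n} → Vec Bool n → ℕ
size []          = 0
size (true ∷ A)  = suc (size A)
size (false ∷ A) = size A
cosize []          = 0
cosize (true ∷ A)  = cosize A
cosize (false ∷ A) = suc (cosize A)

size+cosize : ∀ {n} (A : Vec Bool n) → size A + cosize A ≡ n
size+cosize []          = refl
size+cosize (true ∷ A)  = cong suc (size+cosize A)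
size+cosize (false ∷ A) = trans (+-suc (size A) (cosize A)) (cong suc (size+cosize A))

member : ∀ {n} (A : Vec Bool n) → Fin (size A) → Fin n
member (true ∷ A)  zero    = zero
member (true ∷ A)  (suc k) = suc (member A k)
member (false ∷ A) k       = suc (member A k)

nonmember : ∀ {n} (A : Vec Bool n) → Fin (cosize A) → Fin n
nonmember (true ∷ A)  k       = suc (nonmember A k)
nonmember (false ∷ A) zero    = zero
nonmember (false ∷ A) (suc k) = suc (nonmember A k)

member-sound : ∀ {n} (A : Vec Bool n) k → lookup A (member A k) ≡ true
member-sound (true ∷ A)  zero    = refl
member-sound (true ∷ A)  (suc k) = member-sound A k
member-sound (false ∷ A) k       = member-sound A k

member-complete : ∀ {n} (A : Vec Bool n) i → lookup A i ≡ true → ∃ λ k → member A k ≡ i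
member-complete (true ∷ A) zero _ = zero , refl
member-complete (true ∷ A) (suc i) i∈ with k , refl ← member-complete A i i∈ = suc k , refl
member-complete (false ∷ A) (suc i) i∈ with k , refl ← member-complete A i i∈ = k , refl

nonmember-complete : ∀ {n} (A : Vec Bool n) i → lookup A i ≡ false → ∃ λ k → nonmember A k ≡ i
nonmember-complete (false ∷ A) zero _ = zero , refl
nonmember-complete (false ∷ A) (suc i) i∉ with k , refl ← nonmember-complete A i i∉ = suc k , refl
nonmember-complete (true ∷ A) (suc i) i∉ with k , refl ← nonmember-complete A i i∉ = k , refl

-- sumSubsets n h = Σ h ∣A∣ (n − ∣A∣) over all A ⊆ {1, …, n}
sumSubsets : ℕ → (ℕ → ℕ → ℕ) → ℕ
sumSubsets zero    h = h 0 0
sumSubsets (suc n) h = sumSubsets n (λ p q → h (suc p) q) + sumSubsets n (λ p q → h p (suc q))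

join-injective : ∀ m n {a b : Fin m ⊎ Fin n} → join m n a ≡ join m n b → a ≡ b
join-injective m n {a} {b} eq =
  trans (sym (splitAt-join m n a)) (trans (cong (splitAt m) eq) (splitAt-join m n b))

encodeSubset : ∀ {n} (h : ℕ → ℕ → ℕ) (A : Vec Bool n) → Fin (h (size A) (cosize A)) → Fin (sumSubsets n h)
encodeSubset h []          i = i
encodeSubset h (true ∷ A)  i = join _ _ (inj₁ (encodeSubset (λ p q → h (suc p) q) A i))
encodeSubset {suc n} h (false ∷ A) i =
  join (sumSubsets n (λ p q → h (suc p) q)) _ (inj₂ (encodeSubset (λ p q → h p (suc q)) A i))

-- The types of `i` and `j` depend on the subsets, hence an equality of dependent pairs.
encodeSubset-injective : ∀ {n} h (A B : Vec Bool n) i j → encodeSubset h A i ≡ encodeSubset h B j →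
  _≡_ {A = Σ (Vec Bool n) λ A → Fin (h (size A) (cosize A))} (A , i) (B , j)
encodeSubset-injective h [] [] i j refl = refl
encodeSubset-injective h (true ∷ A) (true ∷ B) i j eq
  with refl ← encodeSubset-injective _ A B i j (inj₁-injective (join-injective _ _ eq)) = refl
encodeSubset-injective {suc n} h (false ∷ A) (false ∷ B) i j eq
  with refl ← encodeSubset-injective _ A B i j (inj₂-injective (join-injective (sumSubsets n _) _ eq)) = refl
encodeSubset-injective {suc n} h (true ∷ A) (false ∷ B) i j eq
  with () ← join-injective (sumSubsets n _) (sumSubsets n _) {inj₁ _} {inj₂ _} eq
encodeSubset-injective {suc n} h (false ∷ A) (true ∷ B) i j eq
  with () ← join-injective (sumSubsets n _) (sumSubsets n _) {inj₂ _} {inj₁ _} eq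

-- The recurrence obtained from modules

module-size : ∀ {n} {c : Matrix n} {A} → Module c A → 2 ≤ size A
module-size {A = A} M with size A | member A | member-complete A
... | zero | _ | complete = contradiction (proj₁ (complete _ (Module.inside₁∈ M))) ¬Fin0
... | suc (suc _) | _ | _ = s≤s (s≤s z≤n)
... | suc zero | _ | complete with complete _ (Module.inside₁∈ M) | complete _ (Module.inside₂∈ M)
...   | zero , refl | zero , eq = contradiction eq (Module.distinct M)

module-cosize : ∀ {n} {c : Matrix n} {A} → Module c A → 1 ≤ cosize A
module-cosize {A = A} M with cosize A | nonmember A | nonmember-complete A
... | zero | _ | complete = contradiction (proj₁ (complete _ (Module.outside∉ M))) ¬Fin0
... | suc _ | _ | _ = s≤s z≤n

adjoin : ∀ {n q} → Fin n → (Fin q → Fin n) → Fin (suc q) → Fin n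
adjoin r κ zero    = r
adjoin r κ (suc k) = κ k

-- A module with p vertices and q vertices outside is determined by its own colouring
-- and by that of the quotient, which has q + 1 vertices.
blocks : (ℕ → ℕ) → ℕ → ℕ → ℕ
blocks K (suc (suc p)) (suc q) = K (2 + p) * K (2 + q)
blocks K _             _       = 0

module Recurrence {n : ℕ} (2≤n : 2 ≤ n) (K : ℕ → ℕ) (codes : ∀ {m} → m < n → Code m (K m)) where

  module _ {p q : ℕ} (eq : 2 + p + suc q ≡ n) where
    module-code : Code (2 + p) (K (2 + p))
    module-code = codes (subst (2 + p <_) eq (m<m+n (2 + p) (s≤s z≤n)))

    quotient-code : Code (2 + q) (K (2 + q))
    quotient-code = codes (subst (2 + q <_) eq (s≤s (s≤s (m≤n+m (suc q) p))))

  -- The quotient is realised inside the colouring, with the first vertex of the module standing for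
  -- all of it; both parts are then pullbacks and remain Gallai.
  encodeBlocks : ∀ {p q} → (Fin p → Fin n) → (Fin q → Fin n) → 2 ≤ p → 1 ≤ q → p + q ≡ n →
    (c : Matrix n) → Gallai c → Fin (blocks K p q)
  encodeBlocks {suc (suc p)} {suc q} ι κ _ _ eq c g = combine
    (Code.encode (module-code eq) (pullback ι c) (gallai-pullback ι g))
    (Code.encode (quotient-code {p} eq) (pullback (adjoin (ι zero) κ) c) (gallai-pullback (adjoin (ι zero) κ) g))
  encodeBlocks {suc zero} _ _ (s≤s ()) _ _ _ _

  -- The size proofs differ on the two sides because they come from two modules. The representative
  -- is existential, since `Fin p` is known to be inhabited only after splitting `p`.
  encodeBlocks-injective : ∀ {p q} (ι : Fin p → Fin n) (κ : Fin q → Fin n) (2≤p 2≤p′ : 2 ≤ p) (1≤q 1≤q′ : 1 ≤ q)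
    (eq : p + q ≡ n) {c d : Matrix n} (gc : Gallai c) (gd : Gallai d) →
    encodeBlocks ι κ 2≤p 1≤q eq c gc ≡ encodeBlocks ι κ 2≤p′ 1≤q′ eq d gd →
    pullback ι c ≗₂ pullback ι d × ∃ λ r → pullback (adjoin (ι r) κ) c ≗₂ pullback (adjoin (ι r) κ) d
  encodeBlocks-injective {suc (suc p)} {suc q} ι κ _ _ _ _ eq gc gd same
    with in-module , in-quotient ← combine-injective {K (2 + p)} {K (2 + q)} _ _ _ _ same =
      Code.injective (module-code eq) (gallai-pullback ι gc) (gallai-pullback ι gd) in-module ,
      zero , Code.injective (quotient-code {p} eq)
        (gallai-pullback (adjoin (ι zero) κ) gc) (gallai-pullback (adjoin (ι zero) κ) gd) in-quotient
  encodeBlocks-injective {suc zero} _ _ (s≤s ())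

  encodeModule : ∀ {c} → Gallai c → ∃ (Module c) → Σ (Vec Bool n) λ A → Fin (blocks K (size A) (cosize A))
  encodeModule {c} g (A , M) =
    A , encodeBlocks (member A) (nonmember A) (module-size M) (module-cosize M) (size+cosize A) c g

  -- Pairs inside the module are read off its own colouring and pairs outside off the quotient; a
  -- crossing pair has the colour of the representative, by uniformity in `c` and in `d`.
  encodeModule-injective : ∀ {c d} (gc : Gallai c) (gd : Gallai d) (M : ∃ (Module c)) (N : ∃ (Module d)) →
    encodeModule gc M ≡ encodeModule gd N → c ≗₂ d
  encodeModule-injective {c} {d} gc gd (A , M) (B , N) same with cong proj₁ same
  ... | refl with encodeBlocks-injective (member A) (nonmember A) (module-size M) (module-size N)
                    (module-cosize M) (module-cosize N) (size+cosize A) gc gd (second same)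
    where
    second : ∀ {i j : Fin (blocks K (size A) (cosize A))} →
      _≡_ {A = Σ (Vec Bool n) λ A → Fin (blocks K (size A) (cosize A))} (A , i) (A , j) → i ≡ j
    second refl = refl
  ...   | in-module , r , in-quotient = agree
    where
    across : ∀ i j → lookup A i ≡ true → lookup A j ≡ false → c i j ≡ d i j
    across i j i∈ j∉ with k , refl ← nonmember-complete A j j∉ =
      trans (Module.uniform M i (member A r) _ i∈ (member-sound A r) j∉)
        (trans (in-quotient zero (suc k)) (Module.uniform N (member A r) i _ (member-sound A r) i∈ j∉))
    agree : c ≗₂ d
    agree i j with lookup A i in i? | lookup A j in j?
    ... | true | false = across i j i? j?
    ... | false | true = trans (symmetric gc i j) (trans (across j i j? i?) (symmetric gd j i))
    ... | true | true with k , refl ← member-complete A i i? | l , refl ← member-complete A j j? = in-module k l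
    ... | false | false with k , refl ← nonmember-complete A i i? | l , refl ← nonmember-complete A j j? =
      in-quotient (suc k) (suc l)

  Shape : Matrix n → Set
  Shape c = (∃ λ x → Misses x c) ⊎ ∃ (Module c)

  shape : ∀ {c} → Gallai c → Shape c
  shape {c} g with misses-or-uses-all c
  ... | inj₁ missing = inj₁ missing
  ... | inj₂ uses    = inj₂ (exists-module 2≤n g uses)

  encodeShape : ∀ {c} → Gallai c → Shape c → Fin (3 * pairPower n) ⊎ Fin (sumSubsets n (blocks K))
  encodeShape {c} g (inj₁ (x , _)) = inj₁ (combine (colorIndex x) (encodeMissing x c))
  encodeShape g (inj₂ M) = inj₂ (encodeSubset (blocks K) (proj₁ (encodeModule g M)) (proj₂ (encodeModule g M)))

  encodeShape-injective : ∀ {c d} (gc : Gallai c) (gd : Gallai d) (s : Shape c) (t : Shape d) →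
    encodeShape gc s ≡ encodeShape gd t → c ≗₂ d
  encodeShape-injective gc gd (inj₁ (x , mc)) (inj₁ (y , md)) same
    with combine-injective {3} {pairPower n} (colorIndex x) _ (colorIndex y) _ (inj₁-injective same)
  ... | x≡y , rest with refl ← colorIndex-injective x≡y = encodeMissing-injective x gc gd mc md rest
  encodeShape-injective gc gd (inj₂ M) (inj₂ N) same =
    encodeModule-injective gc gd M N (encodeSubset-injective (blocks K) _ _ _ _ (inj₂-injective same))

  code-recurrence : Code n (3 * pairPower n + sumSubsets n (blocks K))
  code-recurrence = record
    { encode = λ c g → join _ _ (encodeShape g (shape g))
    ; injective = λ gc gd same → encodeShape-injective gc gd (shape gc) (shape gd) (join-injective _ _ same)
    }

-- Solving the recurrence

pairPower≡ : ∀ n → pairPower n ≡ 2 ^ (n C 2)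
pairPower≡ zero = refl
pairPower≡ (suc n) = begin-equality
  2 ^ n * pairPower n        ≡⟨ cong (2 ^ n *_) (pairPower≡ n) ⟩
  2 ^ n * 2 ^ (n C 2)        ≡⟨ ^-distribˡ-+-* 2 n (n C 2) ⟨
  2 ^ (n + n C 2)            ≡⟨ cong (λ m → 2 ^ (m + n C 2)) (nC1≡n n) ⟨
  2 ^ (n C 1 + n C 2)        ≡⟨ cong (2 ^_) (nCk+nC[k+1]≡[n+1]C[k+1] n 1) ⟩
  2 ^ (suc n C 2)            ∎
  where open ≤-Reasoning

-- Two cliques of a + 1 and b + 1 vertices sharing one vertex cover all but a * b edges of the
-- clique on their union.
pairPower-split : ∀ a b → pairPower (suc a) * pairPower (suc b) * 2 ^ (a * b) ≡ pairPower (suc (a + b))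
pairPower-split zero b = ring (pairPower (suc b))
  where
  ring : ∀ t → 1 * t * 1 ≡ t
  ring = solve-∀
pairPower-split (suc a) b = begin-equality
  2 ^ suc a * pairPower (suc a) * pairPower (suc b) * 2 ^ (b + a * b)
    ≡⟨ cong (2 ^ suc a * pairPower (suc a) * pairPower (suc b) *_) (^-distribˡ-+-* 2 b (a * b)) ⟩
  2 ^ suc a * pairPower (suc a) * pairPower (suc b) * (2 ^ b * 2 ^ (a * b))
    ≡⟨ ring (2 ^ suc a) (pairPower (suc a)) (pairPower (suc b)) (2 ^ b) (2 ^ (a * b)) ⟩
  2 ^ suc a * 2 ^ b * (pairPower (suc a) * pairPower (suc b) * 2 ^ (a * b))
    ≡⟨ cong₂ _*_ (sym (^-distribˡ-+-* 2 (suc a) b)) (pairPower-split a b) ⟩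
  2 ^ (suc a + b) * pairPower (suc (a + b)) ∎
  where
  open ≤-Reasoning
  ring : ∀ u v w x y → u * v * w * (x * y) ≡ u * x * (v * w * y)
  ring = solve-∀

sumSubsets-mono : ∀ n {f h} → (∀ p q → p + q ≡ n → f p q ≤ h p q) → sumSubsets n f ≤ sumSubsets n h
sumSubsets-mono zero    f≤h = f≤h 0 0 refl
sumSubsets-mono (suc n) f≤h = +-mono-≤
  (sumSubsets-mono n λ p q eq → f≤h (suc p) q (cong suc eq))
  (sumSubsets-mono n λ p q eq → f≤h p (suc q) (trans (+-suc p q) (cong suc eq)))

sumSubsets-* : ∀ n a f → sumSubsets n (λ p q → a * f p q) ≡ a * sumSubsets n f
sumSubsets-* zero    a f = refl
sumSubsets-* (suc n) a f = trans
  (cong₂ _+_ (sumSubsets-* n a (λ p q → f (suc p) q)) (sumSubsets-* n a (λ p q → f p (suc q))))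
  (sym (*-distribˡ-+ a _ _))

sumSubsets-+ : ∀ n f h → sumSubsets n (λ p q → f p q + h p q) ≡ sumSubsets n f + sumSubsets n h
sumSubsets-+ zero    f h = refl
sumSubsets-+ (suc n) f h = trans
  (cong₂ _+_ (sumSubsets-+ n (λ p q → f (suc p) q) (λ p q → h (suc p) q))
             (sumSubsets-+ n (λ p q → f p (suc q)) (λ p q → h p (suc q))))
  (interchange (sumSubsets n (λ p q → f (suc p) q)) (sumSubsets n (λ p q → h (suc p) q)) _ _)
  where
  interchange : ∀ a b c d → a + b + (c + d) ≡ a + c + (b + d)
  interchange = solve-∀

sumSubsets-const : ∀ n a → sumSubsets n (λ _ _ → a) ≡ 2 ^ n * a
sumSubsets-const zero    a = sym (*-identityˡ a)
sumSubsets-const (suc n) a rewrite sumSubsets-const n a = ring (2 ^ n) a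
  where
  ring : ∀ x a → x * a + x * a ≡ 2 * x * a
  ring = solve-∀

δ : ℕ → ℕ → ℕ
δ zero    zero    = 1
δ zero    (suc _) = 0
δ (suc _) zero    = 0
δ (suc m) (suc k) = δ m k

sumSubsets-size0 : ∀ n → sumSubsets n (λ p _ → δ 0 p) ≡ 1
sumSubsets-size0 zero    = refl
sumSubsets-size0 (suc n) rewrite sumSubsets-const n 0 | *-zeroʳ (2 ^ n) = sumSubsets-size0 n

sumSubsets-size1 : ∀ n → sumSubsets n (λ p _ → δ 1 p) ≡ n
sumSubsets-size1 zero    = refl
sumSubsets-size1 (suc n) = cong₂ _+_ (sumSubsets-size0 n) (sumSubsets-size1 n)

-- The sum is n choose 2; the rounder n * n is enough.
sumSubsets-size2 : ∀ n → 2 * sumSubsets n (λ p _ → δ 2 p) ≤ n * n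
sumSubsets-size2 zero    = z≤n
sumSubsets-size2 (suc n) = begin
  2 * (sumSubsets n (λ p _ → δ 1 p) + s) ≡⟨ cong (λ t → 2 * (t + s)) (sumSubsets-size1 n) ⟩
  2 * (n + s)                            ≡⟨ *-distribˡ-+ 2 n s ⟩
  2 * n + 2 * s                          ≤⟨ +-monoʳ-≤ (2 * n) (sumSubsets-size2 n) ⟩
  2 * n + n * n                          ≤⟨ n≤1+n _ ⟩
  1 + (2 * n + n * n)                    ≡⟨ ring n ⟩
  suc n * suc n                          ∎
  where
  open ≤-Reasoning
  s = sumSubsets n (λ p _ → δ 2 p)
  ring : ∀ n → 1 + (2 * n + n * n) ≡ suc n * suc n
  ring = solve-∀

sumSubsets-cosize0 : ∀ n → sumSubsets n (λ _ q → δ 0 q) ≡ 1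
sumSubsets-cosize0 zero    = refl
sumSubsets-cosize0 (suc n) rewrite sumSubsets-const n 0 | *-zeroʳ (2 ^ n) =
  trans (+-identityʳ _) (sumSubsets-cosize0 n)

sumSubsets-cosize1 : ∀ n → sumSubsets n (λ _ q → δ 1 q) ≡ n
sumSubsets-cosize1 zero    = refl
sumSubsets-cosize1 (suc n) =
  trans (cong₂ _+_ (sumSubsets-cosize1 n) (sumSubsets-cosize0 n)) (+-comm n 1)

-- Modules with two vertices, or with one vertex outside, dominate the sum over modules.
weight : ℕ → ℕ → ℕ → ℕ
weight α p q = α * (δ 2 p + δ 1 q) + 2

sumSubsets-weight : ∀ n α → 2 * sumSubsets n (weight α) ≤ α * (n * n + 2 * n) + 4 * 2 ^ n
sumSubsets-weight n α = begin
  2 * sumSubsets n (weight α)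
    ≡⟨ cong (2 *_) (trans (sumSubsets-+ n (λ p q → α * (δ 2 p + δ 1 q)) (λ _ _ → 2))
         (cong₂ _+_ (trans (sumSubsets-* n α (λ p q → δ 2 p + δ 1 q))
           (cong (α *_) (trans (sumSubsets-+ n (λ p _ → δ 2 p) (λ _ q → δ 1 q)) (cong (s +_) (sumSubsets-cosize1 n)))))
           (sumSubsets-const n 2))) ⟩
  2 * (α * (s + n) + 2 ^ n * 2)         ≡⟨ ring α s n (2 ^ n) ⟩
  α * (2 * s + 2 * n) + 4 * 2 ^ n       ≤⟨ +-monoˡ-≤ (4 * 2 ^ n) (*-monoʳ-≤ α (+-monoˡ-≤ (2 * n) (sumSubsets-size2 n))) ⟩
  α * (n * n + 2 * n) + 4 * 2 ^ n       ∎
  where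
  open ≤-Reasoning
  s = sumSubsets n (λ p _ → δ 2 p)
  ring : ∀ α s n x → 2 * (α * (s + n) + x * 2) ≡ α * (2 * s + 2 * n) + 4 * x
  ring = solve-∀

-- Here (a + 1)(b + 1) = 2s + (a - 1)(b - 1). If a and b are positive this is at least 2s and the
-- constant 2 of `weight` suffices; otherwise it is s + 1 and the term 2 ^ s fills the gap.
exponents : ∀ a b → let s = a + b in
  2 * (2 ^ s * 2 ^ s) ≤ weight (2 ^ s) (2 + a) (suc b) * 2 ^ (suc a * suc b)
exponents zero b = begin
  2 * (2 ^ b * 2 ^ b)                             ≡⟨ ring (2 ^ b) ⟩
  2 ^ b * 2 ^ (suc b)                             ≤⟨ *-mono-≤ (small (2 ^ b) (δ 1 (suc b))) (≤-reflexive (cong (2 ^_) (sym (*-identityˡ (suc b))))) ⟩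
  weight (2 ^ b) 2 (suc b) * 2 ^ (1 * suc b)      ∎
  where
  open ≤-Reasoning
  ring : ∀ x → 2 * (x * x) ≡ x * (2 * x)
  ring = solve-∀
  small : ∀ x y → x ≤ x * (1 + y) + 2
  small x y = ≤-trans (m≤m*n x (1 + y)) (m≤m+n _ 2)
exponents (suc a) zero rewrite +-identityʳ a = begin
  2 * (2 ^ suc a * 2 ^ suc a)                             ≡⟨ ring (2 ^ suc a) ⟩
  2 ^ suc a * 2 ^ suc (suc a)                             ≤⟨ *-mono-≤ (small (2 ^ suc a)) (≤-reflexive (cong (2 ^_) (sym (*-identityʳ (suc (suc a)))))) ⟩
  weight (2 ^ suc a) (3 + a) 1 * 2 ^ (suc (suc a) * 1)    ∎
  where
  open ≤-Reasoning
  ring : ∀ x → 2 * (x * x) ≡ x * (2 * x)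
  ring = solve-∀
  small : ∀ x → x ≤ x * (0 + 1) + 2
  small x = ≤-trans (m≤m*n x 1) (m≤m+n _ 2)
exponents (suc a) (suc b) = *-mono-≤ {2} (m≤n+m 2 (2 ^ (suc a + suc b) * 0)) (begin
  2 ^ s * 2 ^ s                ≡⟨ ^-distribˡ-+-* 2 s s ⟨
  2 ^ (s + s)                  ≤⟨ ^-monoʳ-≤ 2 (≤-trans (m≤m+n (s + s) (a * b)) (≤-reflexive (ring a b))) ⟩
  2 ^ ((2 + a) * (2 + b))      ∎)
  where
  open ≤-Reasoning
  s = suc a + suc b
  ring : ∀ a b → suc a + suc b + (suc a + suc b) + a * b ≡ (2 + a) * (2 + b)
  ring = solve-∀

module BlockSum (K : ℕ → ℕ) (d : ℕ) (K≤ : ∀ n → K n ≤ d * pairPower n) where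

  -- With p = 2 + a and q = 1 + b, `s` is a + b. The factor on the left replaces a division by the
  -- power of two from `pairPower-split`.
  blocks-bound : ∀ s p q → p + q ≡ 3 + s →
    2 * (2 ^ s * 2 ^ s) * blocks K p q ≤ d * d * pairPower (3 + s) * weight (2 ^ s) p q
  blocks-bound s zero q eq rewrite *-zeroʳ (2 * (2 ^ s * 2 ^ s)) = z≤n
  blocks-bound s (suc zero) q eq rewrite *-zeroʳ (2 * (2 ^ s * 2 ^ s)) = z≤n
  blocks-bound s (suc (suc p)) zero eq rewrite *-zeroʳ (2 * (2 ^ s * 2 ^ s)) = z≤n
  blocks-bound s (suc (suc a)) (suc b) eq
    with refl ← ℕ-suc-injective (trans (sym (+-suc a b)) (ℕ-suc-injective (ℕ-suc-injective eq))) = begin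
    2 * (2 ^ (a + b) * 2 ^ (a + b)) * (K (2 + a) * K (2 + b))
      ≤⟨ *-mono-≤ (exponents a b) (*-mono-≤ (K≤ (2 + a)) (K≤ (2 + b))) ⟩
    w * 2 ^ (suc a * suc b) * (d * pairPower (2 + a) * (d * pairPower (2 + b)))
      ≡⟨ ring w (2 ^ (suc a * suc b)) (pairPower (2 + a)) (pairPower (2 + b)) d ⟩
    d * d * (pairPower (2 + a) * pairPower (2 + b) * 2 ^ (suc a * suc b)) * w
      ≡⟨ cong (λ t → d * d * t * w)
           (trans (pairPower-split (suc a) (suc b)) (cong (λ m → pairPower (2 + m)) (+-suc a b))) ⟩
    d * d * pairPower (3 + (a + b)) * w ∎
    where
    open ≤-Reasoning
    w = weight (2 ^ (a + b)) (2 + a) (suc b)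
    ring : ∀ w e x y d → w * e * (d * x * (d * y)) ≡ d * d * (x * y * e) * w
    ring = solve-∀

  -- The factor n² + 2n + 32 is the bound of `sumSubsets-weight` divided by 2 ^ s, as 4 * 2 ^ n = 32
  -- * 2 ^ s.
  sum-blocks : ∀ s c → let n = 3 + s in d * d * (n * n + 2 * n + 32) ≤ c * (4 * 2 ^ s) →
    sumSubsets n (blocks K) ≤ c * pairPower n
  sum-blocks s c small = *-cancelˡ-≤ (4 * (x * x)) {{nonzero}} (begin
    4 * (x * x) * sumSubsets n (blocks K)
      ≡⟨ ring₁ x _ ⟩
    2 * (2 * (x * x) * sumSubsets n (blocks K))
      ≡⟨ cong (2 *_) (sumSubsets-* n (2 * (x * x)) (blocks K)) ⟨
    2 * sumSubsets n (λ p q → 2 * (x * x) * blocks K p q)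
      ≤⟨ *-monoʳ-≤ 2 (sumSubsets-mono n (blocks-bound s)) ⟩
    2 * sumSubsets n (λ p q → d * d * t * weight x p q)
      ≡⟨ cong (2 *_) (sumSubsets-* n (d * d * t) (weight x)) ⟩
    2 * (d * d * t * sumSubsets n (weight x))
      ≡⟨ ring₂ (d * d * t) _ ⟩
    d * d * t * (2 * sumSubsets n (weight x))
      ≤⟨ *-monoʳ-≤ (d * d * t) (sumSubsets-weight n x) ⟩
    d * d * t * (x * (n * n + 2 * n) + 4 * (2 * (2 * (2 * x))))
      ≡⟨ ring₃ (d * d) t x (n * n + 2 * n) ⟩
    t * x * (d * d * (n * n + 2 * n + 32))
      ≤⟨ *-monoʳ-≤ (t * x) small ⟩
    t * x * (c * (4 * x))
      ≡⟨ ring₄ t x c ⟩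
    4 * (x * x) * (c * t) ∎)
    where
    open ≤-Reasoning
    n = 3 + s
    x = 2 ^ s
    t = pairPower n
    nonzero : NonZero (4 * (x * x))
    nonzero = m*n≢0 4 (x * x) {{_}} {{m*n≢0 x x {{m^n≢0 2 s}} {{m^n≢0 2 s}}}}
    ring₁ : ∀ x y → 4 * (x * x) * y ≡ 2 * (2 * (x * x) * y)
    ring₁ = solve-∀
    ring₂ : ∀ x y → 2 * (x * y) ≡ x * (2 * y)
    ring₂ = solve-∀
    ring₃ : ∀ e t x m → e * t * (x * m + 4 * (2 * (2 * (2 * x)))) ≡ t * x * (e * (m + 32))
    ring₃ = solve-∀
    ring₄ : ∀ t x c → t * x * (c * (4 * x)) ≡ 4 * (x * x) * (c * t)
    ring₄ = solve-∀

  recurrence : ∀ s c → let n = 3 + s in d * d * (n * n + 2 * n + 32) ≤ c * (4 * 2 ^ s) →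
    3 * pairPower n + sumSubsets n (blocks K) ≤ (3 + c) * pairPower n
  recurrence s c small = ≤-trans (+-monoʳ-≤ (3 * pairPower (3 + s)) (sum-blocks s c small))
    (≤-reflexive (sym (*-distribʳ-+ (pairPower (3 + s)) 3 c)))

-- The hypothesis of sum-blocks survives increasing n, since a quadratic at most doubles.
quadratic≤exponential : ∀ e c s → let n = 3 + s in e * (n * n + 2 * n + 32) ≤ c * (4 * 2 ^ s) →
  ∀ k → let n = 3 + (k + s) in e * (n * n + 2 * n + 32) ≤ c * (4 * 2 ^ (k + s))
quadratic≤exponential e c s small zero    = small
quadratic≤exponential e c s small (suc k) = begin
  e * (suc n * suc n + 2 * suc n + 32)                    ≤⟨ *-monoʳ-≤ e (m≤m+n _ (n * n + 29)) ⟩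
  e * (suc n * suc n + 2 * suc n + 32 + (n * n + 29))     ≡⟨ ring e n ⟩
  2 * (e * (n * n + 2 * n + 32))                          ≤⟨ *-monoʳ-≤ 2 (quadratic≤exponential e c s small k) ⟩
  2 * (c * (4 * 2 ^ (k + s)))                             ≡⟨ ring′ c (2 ^ (k + s)) ⟩
  c * (4 * (2 * 2 ^ (k + s)))                             ∎
  where
  open ≤-Reasoning
  n = 3 + (k + s)
  ring : ∀ e n → e * (suc n * suc n + 2 * suc n + 32 + (n * n + 29)) ≡ 2 * (e * (n * n + 2 * n + 32))
  ring = solve-∀
  ring′ : ∀ c x → 2 * (c * (4 * x)) ≡ c * (4 * (2 * x))
  ring′ = solve-∀

-- The explicit bound and the induction

bound : ℕ → ℕ
-- Each insertion almost doubles the ratio to `pairPower`: it is about 37 at n = 7 and 74 at n = 8,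
-- which exceeds 7 * 9 = 63.
bound n = if n <ᵇ 8 then insertionBound n else 48 * pairPower n

bound≤48 : ∀ n → bound n ≤ 48 * pairPower n
bound≤48 0 = ≤ᵇ⇒≤ _ _ tt
bound≤48 1 = ≤ᵇ⇒≤ _ _ tt
bound≤48 2 = ≤ᵇ⇒≤ _ _ tt
bound≤48 3 = ≤ᵇ⇒≤ _ _ tt
bound≤48 4 = ≤ᵇ⇒≤ _ _ tt
bound≤48 5 = ≤ᵇ⇒≤ _ _ tt
bound≤48 6 = ≤ᵇ⇒≤ _ _ tt
bound≤48 7 = ≤ᵇ⇒≤ _ _ tt
bound≤48 (suc (suc (suc (suc (suc (suc (suc (suc n)))))))) = ≤-refl

-- Of the constant 48, colourings missing a colour take 3 and leave 45 for modules. The inequality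
-- fails at 14 in place of 15.
small-at-15 : 48 * 48 * (15 * 15 + 2 * 15 + 32) ≤ 45 * (4 * 2 ^ 12)
small-at-15 = ≤ᵇ⇒≤ _ _ tt

recurrence-large : ∀ k → let n = 15 + k in 3 * pairPower n + sumSubsets n (blocks bound) ≤ 48 * pairPower n
recurrence-large k = subst (λ n → 3 * pairPower n + sumSubsets n (blocks bound) ≤ 48 * pairPower n)
  (cong (3 +_) (+-comm k 12))
  (BlockSum.recurrence bound 48 bound≤48 (k + 12) 45 (quadratic≤exponential (48 * 48) 45 12 small-at-15 k))

-- From n = 8 to 14 the estimate behind `small-at-15` is too crude, so the recurrence is evaluated
-- exactly.
recurrence≤bound : ∀ m → let n = 8 + m in 3 * pairPower n + sumSubsets n (blocks bound) ≤ bound n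
recurrence≤bound 0 = ≤ᵇ⇒≤ _ _ tt
recurrence≤bound 1 = ≤ᵇ⇒≤ _ _ tt
recurrence≤bound 2 = ≤ᵇ⇒≤ _ _ tt
recurrence≤bound 3 = ≤ᵇ⇒≤ _ _ tt
recurrence≤bound 4 = ≤ᵇ⇒≤ _ _ tt
recurrence≤bound 5 = ≤ᵇ⇒≤ _ _ tt
recurrence≤bound 6 = ≤ᵇ⇒≤ _ _ tt
recurrence≤bound (suc (suc (suc (suc (suc (suc (suc k))))))) = recurrence-large k

code-bound : ∀ n → Code n (bound n)
code-bound = <-rec _ step
  where
  step : ∀ n → (∀ {m} → m < n → Code m (bound m)) → Code n (bound n)
  step 0 codes = code-insertion 0
  step 1 codes = code-insertion 1
  step 2 codes = code-insertion 2
  step 3 codes = code-insertion 3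
  step 4 codes = code-insertion 4
  step 5 codes = code-insertion 5
  step 6 codes = code-insertion 6
  step 7 codes = code-insertion 7
  step n@(suc (suc (suc (suc (suc (suc (suc (suc m)))))))) codes =
    code-mono (recurrence≤bound m) (Recurrence.code-recurrence (s≤s (s≤s z≤n)) bound codes)

-- From n = 8 on, 7 * (n + 1) is at least 63, which exceeds 48; smaller cases are computed.
bound≤ : ∀ n → bound n ≤ 7 * (n + 1) * pairPower n
bound≤ 0 = ≤ᵇ⇒≤ _ _ tt
bound≤ 1 = ≤ᵇ⇒≤ _ _ tt
bound≤ 2 = ≤ᵇ⇒≤ _ _ tt
bound≤ 3 = ≤ᵇ⇒≤ _ _ tt
bound≤ 4 = ≤ᵇ⇒≤ _ _ tt
bound≤ 5 = ≤ᵇ⇒≤ _ _ tt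
bound≤ 6 = ≤ᵇ⇒≤ _ _ tt
bound≤ 7 = ≤ᵇ⇒≤ _ _ tt
bound≤ n@(suc (suc (suc (suc (suc (suc (suc (suc m)))))))) =
  *-monoˡ-≤ (pairPower n) {48} {7 * (n + 1)}
    (≤-trans (≤ᵇ⇒≤ 48 63 tt) (*-monoʳ-≤ 7 {9} (s≤s (s≤s (s≤s (s≤s (s≤s (s≤s (s≤s (s≤s (m≤n+m 1 m)))))))))))

-- From colourings of edges to matrices

matrix : ∀ {n} → Coloring n → Matrix n
matrix φ i j with <-cmp i j
... | tri< i<j _ _ = φ (i , j , i<j)
... | tri≈ _ _ _   = red
... | tri> _ _ j<i = φ (j , i , j<i)

matrix-< : ∀ {n} (φ : Coloring n) {i j} (i<j : i <ᶠ j) → matrix φ i j ≡ φ (i , j , i<j)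
matrix-< φ {i} {j} i<j with <-cmp i j
... | tri< i<j′ _ _ = cong (λ p → φ (i , j , p)) (<-irrelevant i<j′ i<j)
... | tri≈ i≮j _ _  = contradiction i<j i≮j
... | tri> i≮j _ _  = contradiction i<j i≮j

matrix-symmetric : ∀ {n} (φ : Coloring n) i j → matrix φ i j ≡ matrix φ j i
matrix-symmetric φ i j with <-cmp i j
... | tri< i<j _ _  = sym (flip i<j)
  where
  flip : ∀ {i j} (i<j : i <ᶠ j) → matrix φ j i ≡ φ (i , j , i<j)
  flip {i} {j} i<j with <-cmp j i
  ... | tri< _ _ i≮j = contradiction i<j i≮j
  ... | tri≈ _ _ i≮j = contradiction i<j i≮j
  ... | tri> _ _ i<j′ = cong (λ p → φ (i , j , p)) (<-irrelevant i<j′ i<j)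
... | tri> _ _ j<i  = sym (matrix-< φ j<i)
... | tri≈ _ refl _ with <-cmp i i
...   | tri< _ i≢i _ = contradiction refl i≢i
...   | tri≈ _ _ _ = refl
...   | tri> _ i≢i _ = contradiction refl i≢i

-- `HasRainbowTriangle` speaks of increasing triples only. Swaps and rotations sort any other
-- triple, and a triple with a repeated vertex has two equal entries.
matrix-gallai : ∀ {n} ((φ , _) : RainbowFree n) → Gallai (matrix φ)
matrix-gallai {n} (φ , free) = record
  { diagonal = diag ; symmetric = matrix-symmetric φ
  ; rainbow-free = λ i j k → sorted i j k (<-cmp i j) (<-cmp j k) (<-cmp i k) }
  where
  M = matrix φ
  diag : ∀ i → M i i ≡ red
  diag i with <-cmp i i
  ... | tri< _ i≢i _ = contradiction refl i≢i
  ... | tri≈ _ _ _ = refl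
  ... | tri> _ i≢i _ = contradiction refl i≢i

  Rainbow : Fin n → Fin n → Fin n → Set
  Rainbow i j k = AllDistinct (M i j) (M j k) (M i k)

  swap : ∀ i j k → Rainbow i j k → Rainbow j i k
  swap i j k (p , q , r) =
    (λ e → r (trans (matrix-symmetric φ i j) e)) ,
    ≢-sym q ,
    (λ e → p (trans (matrix-symmetric φ i j) e))

  rotate : ∀ i j k → Rainbow i j k → Rainbow j k i
  rotate i j k (p , q , r) =
    (λ e → q (trans e (matrix-symmetric φ k i))) ,
    (λ e → r (trans (matrix-symmetric φ i j) (trans (sym e) (matrix-symmetric φ k i)))) ,
    (λ e → p (trans (matrix-symmetric φ i j) (sym e)))

  increasing : ∀ {i j k} → i <ᶠ j → j <ᶠ k → ¬ Rainbow i j k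
  increasing {i} {j} {k} i<j j<k rainbow
    rewrite matrix-< φ i<j | matrix-< φ j<k | matrix-< φ {i} {k} (<-trans i<j j<k) =
    free (i , j , k , i<j , j<k , <-trans i<j j<k , rainbow)

  sorted : ∀ i j k → Tri (i <ᶠ j) (i ≡ j) (j <ᶠ i) → Tri (j <ᶠ k) (j ≡ k) (k <ᶠ j) →
    Tri (i <ᶠ k) (i ≡ k) (k <ᶠ i) → ¬ Rainbow i j k
  sorted i j k (tri≈ _ refl _) _ _ (_ , q , _) = q refl
  sorted i j k _ (tri≈ _ refl _) _ (_ , _ , r) = r refl
  sorted i j k _ _ (tri≈ _ refl _) (p , _ , _) = p (matrix-symmetric φ i j)
  sorted i j k (tri< i<j _ _) (tri< j<k _ _) _              = increasing i<j j<k
  sorted i j k (tri< _ _ _)   (tri> _ _ k<j) (tri< i<k _ _) = increasing i<k k<j ∘ swap k i j ∘ rotate j k i ∘ rotate i j k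
  sorted i j k (tri< i<j _ _) (tri> _ _ k<j) (tri> _ _ k<i) = increasing k<i i<j ∘ rotate j k i ∘ rotate i j k
  sorted i j k (tri> _ _ j<i) (tri< _ _ _)   (tri< i<k _ _) = increasing j<i i<k ∘ swap i j k
  sorted i j k (tri> _ _ _)   (tri< j<k _ _) (tri> _ _ k<i) = increasing j<k k<i ∘ rotate i j k
  sorted i j k (tri> _ _ j<i) (tri> _ _ k<j) _              = increasing k<j j<i ∘ swap j k i ∘ rotate i j k

-- Each index is sent to the code of a chosen preimage. Equal codes give pointwise equal colourings,
-- which the bijection sends to the same index.
code⇒count≤ : ∀ {n k l} → Code n l → HasCount n k → k ≤ l
code⇒count≤ {n} {k} {l} 𝒞 β = injective⇒≤ {f = λ i → encode (M i) (matrix-gallai (to⁻ i))} inj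
  where
  open Code 𝒞
  module β = Bijection β
  to⁻ : Fin k → RainbowFree n
  to⁻ i = proj₁ (β.strictlySurjective i)
  M : Fin k → Matrix n
  M i = matrix (proj₁ (to⁻ i))
  inj : ∀ {i j} → encode (M i) (matrix-gallai (to⁻ i)) ≡ encode (M j) (matrix-gallai (to⁻ j)) → i ≡ j
  inj {i} {j} eq = trans (sym (proj₂ (β.strictlySurjective i))) (trans (β.cong same) (proj₂ (β.strictlySurjective j)))
    where
    agree : M i ≗₂ M j
    agree = injective (matrix-gallai (to⁻ i)) (matrix-gallai (to⁻ j)) eq
    same : (e : Edge n) → proj₁ (to⁻ i) e ≡ proj₁ (to⁻ j) e
    same (u , v , u<v) = trans (sym (matrix-< _ u<v)) (trans (agree u v) (matrix-< _ u<v))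

theorem1p1 : (n k : ℕ) → 2 ≤ n → HasCount n k →
    k ≤ 7 * (n + 1) * 2 ^ (n C 2)
theorem1p1 n k _ count = begin
  k                               ≤⟨ code⇒count≤ (code-bound n) count ⟩
  bound n                         ≤⟨ bound≤ n ⟩
  7 * (n + 1) * pairPower n       ≡⟨ cong (7 * (n + 1) *_) (pairPower≡ n) ⟩
  7 * (n + 1) * 2 ^ (n C 2)       ∎
  where open ≤-Reasoning
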